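{- Let $M$ be an $n\times n$ ($n\geq 2$) primitive Boolean matrix with Boolean rank $b(M)=b$. Then $$k(M)\leq \left\lceil\frac{(b-1)^2+1}{2}\right\rceil +1.$$
   Context: Boolean matrices are $(0,1)$-matrices with Boolean arithmetic ($1+1=1$). A square Boolean matrix $M$ is primitive if some power $M^r$ has all entries equal to $1$. The scrambling index $k(M)$ of a primitive matrix $M$ is the smallest positive integer $k$ such that any two rows of $M^k$ have a $1$ in a common position; equivalently, the smallest $k$ with $M^k(M^t)^k=J$ (the all-ones matrix). The Boolean rank $b(M)$ of an $m\times n$ nonzero Boolean matrix $M$ is the smallest positive integer $b$ such that $M=AB$ for some $m\times b$ Boolean matrix $A$ and $b\times n$ Boolean matrix $B$ (Boolean product). -}

module Defs where

open import Algebra.Bundles using (CommutativeSemiring)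
open import Data.Bool using (Bool; true; _∧_)
open import Data.Bool.Properties using (∨-∧-commutativeSemiring) renaming (_≟_ to _≟ᵇ_)
open import Data.Fin using (Fin)
open import Data.Fin.Properties using (any?; all?) renaming (_≟_ to _≟ᶠ_)
open import Data.Nat using (ℕ; zero; suc; _+_; _≤_; _<_; z≤n; s≤s; s≤s⁻¹)
open import Data.Nat.Properties using (≤-refl; ≮⇒≥; +-suc; +-identityʳ; m≤n⇒m<n∨m≡n)
open import Data.Product using (∃; _×_; _,_; proj₁)
open import Data.Sum using (inj₁; inj₂)
open import Data.Vec.Functional using (Vector)
open import Relation.Binary.PropositionalEquality using (_≡_; refl; subst)
open import Relation.Nullary using (¬_; yes; no; does; contradiction; _×-dec_)
open import Relation.Unary using (Pred; Decidable)
open import Level using (0ℓ)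

open import Algebra.Properties.Semiring.Sum (CommutativeSemiring.semiring ∨-∧-commutativeSemiring) using (sum)

BMatrix : ℕ → ℕ → Set
BMatrix m n = Vector (Vector Bool n) m

-- Matrices are functions, so equality of matrices is entrywise.
infix 4 _≐_
_≐_ : ∀ {m n} → BMatrix m n → BMatrix m n → Set
A ≐ B = ∀ i j → A i j ≡ B i j

-- `sum` is taken in the semiring (Bool, ∨, ∧), so 1 + 1 = 1.
infixl 7 _⊗_
_⊗_ : ∀ {m k n} → BMatrix m k → BMatrix k n → BMatrix m n
(A ⊗ B) i j = sum (λ l → A i l ∧ B l j)

I : ∀ {n} → BMatrix n n
I i j = does (i ≟ᶠ j)

J : ∀ {m n} → BMatrix m n
J i j = true

infixr 8 _^ᵇ_
_^ᵇ_ : ∀ {n} → BMatrix n n → ℕ → BMatrix n n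
M ^ᵇ zero  = I
M ^ᵇ suc r = M ⊗ M ^ᵇ r

Primitive : ∀ {n} → BMatrix n n → Set
Primitive M = ∃ λ r → 1 ≤ r × M ^ᵇ r ≐ J

IsLeastPositive : Pred ℕ 0ℓ → ℕ → Set
IsLeastPositive P k = 1 ≤ k × P k × (∀ j → 1 ≤ j → P j → k ≤ j)

FactorsThrough : ∀ {m n} → BMatrix m n → ℕ → Set
FactorsThrough {m} {n} M b = ∃ λ (A : BMatrix m b) → ∃ λ (B : BMatrix b n) → M ≐ A ⊗ B

-- The Boolean rank is meant for nonzero M only: for a zero matrix this gives 1,
-- not the usual value 0.
IsBooleanRank : ∀ {m n} → BMatrix m n → ℕ → Set
IsBooleanRank M = IsLeastPositive (FactorsThrough M)

-- The case i = j is included, in agreement with M^k (Mᵗ)^k = J; for n ≥ 2 it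
-- follows from the case i ≠ j.
Scrambles : ∀ {n} → BMatrix n n → ℕ → Set
Scrambles M k = ∀ i j → ∃ λ l → (M ^ᵇ k) i l ≡ true × (M ^ᵇ k) j l ≡ true

IsScramblingIndex : ∀ {n} → BMatrix n n → ℕ → Set
IsScramblingIndex M = IsLeastPositive (Scrambles M)

scrambles? : ∀ {n} (M : BMatrix n n) → Decidable (Scrambles M)
scrambles? M k = all? λ i → all? λ j → any? λ l →
  ((M ^ᵇ k) i l ≟ᵇ true) ×-dec ((M ^ᵇ k) j l ≟ᵇ true)

module _ {P : Pred ℕ 0ℓ} (P? : Decidable P) where

  private
    search : ∀ d k → 1 ≤ k → (∀ j → 1 ≤ j → j < k → ¬ P j) →
             P (k + d) → ∃ (IsLeastPositive P)
    search d k 1≤k none p with P? k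
    ... | yes pk = k , 1≤k , pk , λ j 1≤j pj → ≮⇒≥ λ j<k → none j 1≤j j<k pj
    search zero k 1≤k none p | no ¬pk = contradiction (subst P (+-identityʳ k) p) ¬pk
    search (suc d) k 1≤k none p | no ¬pk =
      search d (suc k) (s≤s z≤n) none′ (subst P (+-suc k d) p)
      where
      none′ : ∀ j → 1 ≤ j → j < suc k → ¬ P j
      none′ j 1≤j j<1+k pj with m≤n⇒m<n∨m≡n (s≤s⁻¹ j<1+k)
      ... | inj₁ j<k  = none j 1≤j j<k pj
      ... | inj₂ refl = ¬pk pj

  leastPositive : ∀ r → 1 ≤ r → P r → ∃ (IsLeastPositive P)
  leastPositive (suc d) _ p =
    search d 1 ≤-refl (λ { (suc _) _ (s≤s ()) _ }) p

-- If M^r = J then r itself scrambles, so the least such exponent exists.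
scramblingIndex : ∀ {n} (M : BMatrix n n) → Primitive M → ∃ (IsScramblingIndex M)
scramblingIndex M (r , 1≤r , Mʳ≐J) =
  leastPositive (scrambles? M) r 1≤r (λ i j → i , Mʳ≐J i i , Mʳ≐J j i)

k⟨_,_⟩ : ∀ {n} (M : BMatrix n n) → Primitive M → ℕ
k⟨ M , prim ⟩ = proj₁ (scramblingIndex M prim)

{-# OPTIONS --safe #-}

-- Write M = A B with inner dimension b and put N = B A, a b × b matrix.  Minimality of b
-- forbids zero rows of B and zero columns of A, so N is primitive; and if two rows of Nᵏ
-- always meet, so do two rows of Mᵏ⁺¹ = A Nᵏ B.  It remains to prove the Akelbek–Kirkland
-- bound for N, that is, that any two vertices of a primitive digraph on n ≥ 2 vertices have
-- a common end point of walks of length exactly ⌈((n-1)² + 1)/2⌉.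
--
-- A shortest closed walk has s < n distinct vertices, and every vertex walks into it in
-- exactly n - s steps, so let u and v lie on it, and let S j, T j be the sets reached from u
-- and v in j steps.  Then S j ⊂ S (s + j) strictly until S j is everything.  If n = 2p + 1,
-- then S (p s) and T (p s) have more than p elements each and must meet.  If n = 2p + 2, then
-- S (p s) and T (p s) have at least p + 1 elements each, and if they do not meet they are
-- complementary.  Walk d ≤ s/2 steps from u to v along the cycle (or exchange u and v).  If
-- S (p s + d) and T (p s + d) are still disjoint, counting forces S d = {v}, and so
-- S (p s + 2d) = T (p s + d) is disjoint from S (p s + d) = T (p s), hence lies in S (p s):
-- the sets S then never fill up, contradicting primitivity.

module Submission where

open import Defs
open import Data.Bool using (true; false; _∧_)
open import Data.Bool.Properties using () renaming (_≟_ to _≟ᵇ_)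
open import Data.Empty using (⊥; ⊥-elim)
open import Data.Fin using (Fin; zero; suc; toℕ; fromℕ<; punchIn; punchOut)
open import Data.Fin.Properties using (any?; toℕ<n; toℕ-fromℕ<; toℕ-injective; punchIn-punchOut; 0≢1+n; suc-injective) renaming (_≟_ to _≟ᶠ_)
open import Data.Fin.Subset using (Subset; _∈_; ∣_∣; ∁) renaming (_⊆_ to _⊆ˢ_)
open import Data.Fin.Subset.Properties using (p⊆q⇒∣p∣≤∣q∣; p⊂q⇒∣p∣<∣q∣; ∣∁p∣≡n∸∣p∣; ∣p∣≤n; x∉p⇒x∈∁p)
open import Data.Nat using (ℕ; zero; suc; _+_; _*_; _∸_; _^_; _≤_; _<_; z≤n; s≤s; ⌈_/2⌉; _≤?_)
open import Data.Nat.Properties hiding (0≢1+n; suc-injective)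
open import Data.Nat.Tactic.RingSolver using (solve-∀)
open import Data.Product using (∃; _×_; _,_; proj₁; proj₂)
open import Data.Sum using (_⊎_; inj₁; inj₂; swap)
open import Data.Vec using (tabulate)
open import Data.Vec.Properties using (lookup∘tabulate; []=⇒lookup; lookup⇒[]=)
open import Function using (_∘_)
open import Level using (0ℓ)
open import Relation.Binary.Definitions using (tri<; tri≈; tri>)
open import Relation.Binary.PropositionalEquality using (_≡_; _≢_; refl; sym; trans; cong; subst)
open import Relation.Nullary using (¬_; yes; no; does; contradiction; _⊎-dec_; _×-dec_)
open import Relation.Nullary.Decidable using (decidable-stable; dec-true; map′; ¬?)
open import Relation.Unary using (Pred; Decidable; _⊆_)

open ≤-Reasoning

-- Cardinalities of decidable predicates on Fin n

module _ {n : ℕ} where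

  card : {P : Pred (Fin n) 0ℓ} → Decidable P → ℕ
  card P? = ∣ tabulate (does ∘ P?) ∣

  private
    sep : {P : Pred (Fin n) 0ℓ} → Decidable P → Subset n
    sep P? = tabulate (does ∘ P?)

    sep⁺ : {P : Pred (Fin n) 0ℓ} (P? : Decidable P) → ∀ {x} → P x → x ∈ sep P?
    sep⁺ P? {x} px = lookup⇒[]= x _ (trans (lookup∘tabulate (does ∘ P?) x) (dec-true (P? x) px))

    sep⁻ : {P : Pred (Fin n) 0ℓ} (P? : Decidable P) → ∀ {x} → x ∈ sep P? → P x
    sep⁻ P? {x} x∈ with P? x | trans (sym (lookup∘tabulate (does ∘ P?) x)) ([]=⇒lookup x∈)
    ... | yes px | _ = px
    ... | no _ | ()

  module _ {P Q : Pred (Fin n) 0ℓ} (P? : Decidable P) (Q? : Decidable Q) where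

    card-mono : P ⊆ Q → card P? ≤ card Q?
    card-mono P⊆Q = p⊆q⇒∣p∣≤∣q∣ (sep⁺ Q? ∘ P⊆Q ∘ sep⁻ P?)

    card-strict : P ⊆ Q → (∃ λ x → Q x × ¬ P x) → card P? < card Q?
    card-strict P⊆Q (x , qx , ¬px) =
      p⊂q⇒∣p∣<∣q∣ (sep⁺ Q? ∘ P⊆Q ∘ sep⁻ P? , x , sep⁺ Q? qx , ¬px ∘ sep⁻ P?)

    card-disjoint : (∀ x → P x → ¬ Q x) → card P? + card Q? ≤ n
    card-disjoint disj = begin
      card P? + card Q?         ≤⟨ +-monoʳ-≤ (card P?) (p⊆q⇒∣p∣≤∣q∣ Q⊆∁P) ⟩
      card P? + ∣ ∁ (sep P?) ∣  ≡⟨ cong (card P? +_) (∣∁p∣≡n∸∣p∣ (sep P?)) ⟩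
      card P? + (n ∸ card P?)   ≡⟨ m+[n∸m]≡n (∣p∣≤n (sep P?)) ⟩
      n                         ∎
      where
      Q⊆∁P : sep Q? ⊆ˢ ∁ (sep P?)
      Q⊆∁P x∈Q = x∉p⇒x∈∁p λ x∈P → disj _ (sep⁻ P? x∈P) (sep⁻ Q? x∈Q)

    ⊈-witness : ¬ (Q ⊆ P) → ∃ λ x → Q x × ¬ P x
    ⊈-witness Q⊈P with any? (λ x → Q? x ×-dec ¬? (P? x))
    ... | yes w = w
    ... | no ¬w = contradiction (λ {x} qx → decidable-stable (P? x) λ ¬px → ¬w (x , qx , ¬px)) Q⊈P

  card-nonempty : {P : Pred (Fin n) 0ℓ} (P? : Decidable P) → ∃ P → 1 ≤ card P?
  card-nonempty P? (x , px) =
    ≤-trans (s≤s z≤n) (card-strict {P = λ _ → ⊥} (λ _ → no λ ()) P? (λ ()) (x , px , λ ()))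

  module _ {P : Pred (Fin n) 0ℓ} (P? : Decidable P) where

    card-missing : ∀ x → ¬ P x → card P? < n
    card-missing x ¬px = begin-strict
      card P?                       <⟨ m<m+n (card P?) (card-nonempty (_≟ᶠ x) (x , refl)) ⟩
      card P? + card (_≟ᶠ x)        ≤⟨ card-disjoint P? (_≟ᶠ x) (λ { _ px refl → ¬px px }) ⟩
      n                             ∎

    card≥n⇒full : n ≤ card P? → ∀ x → P x
    card≥n⇒full n≤ x = decidable-stable (P? x) λ ¬px → <⇒≱ (card-missing x ¬px) n≤

    card≤1⇒≡ : card P? ≤ 1 → ∀ {x y} → P x → P y → x ≡ y
    card≤1⇒≡ ≤1 {x} {y} px py = decidable-stable (x ≟ᶠ y) λ x≢y → <⇒≱ (s≤s ≤1) (begin-strict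
      1               ≤⟨ card-nonempty (_≟ᶠ x) (x , refl) ⟩
      card (_≟ᶠ x)    <⟨ card-strict (_≟ᶠ x) P? (λ { refl → px }) (y , py , x≢y ∘ sym) ⟩
      card P?         ∎)

  -- If `x` lay outside both sets, adding it to `P` would keep them disjoint and push their total
  -- size past `n`.
  card-complement : {P Q : Pred (Fin n) 0ℓ} (P? : Decidable P) (Q? : Decidable Q) →
    (∀ x → P x → ¬ Q x) → n ≤ card P? + card Q? → ∀ {x} → ¬ Q x → P x
  card-complement {P} {Q} P? Q? disj n≤ {x} ¬qx = decidable-stable (P? x) λ ¬px → <⇒≱ (begin-strict
      card P? + card Q?    <⟨ +-monoˡ-< (card Q?) (card-strict P? P+x? inj₁ (x , inj₂ refl , ¬px)) ⟩
      card P+x? + card Q?  ≤⟨ card-disjoint P+x? Q? (λ { y (inj₁ py) qy → disj y py qy ; _ (inj₂ refl) qx → ¬qx qx }) ⟩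
      n                    ∎) n≤
    where
    P+x? : Decidable (λ y → P y ⊎ y ≡ x)
    P+x? y = P? y ⊎-dec (y ≟ᶠ x)

  image? : ∀ {m} (f : Fin m → Fin n) → Decidable (λ x → ∃ λ i → f i ≡ x)
  image? f x = any? λ i → f i ≟ᶠ x

  card-image : ∀ {m} (f : Fin m → Fin n) → (∀ {i j} → f i ≡ f j → i ≡ j) → m ≤ card (image? f)
  card-image {zero} f inj = z≤n
  card-image {suc m} f inj = begin-strict
    m                       ≤⟨ card-image (f ∘ suc) (suc-injective ∘ inj) ⟩
    card (image? (f ∘ suc)) <⟨ card-strict (image? (f ∘ suc)) (image? f) (λ (i , eq) → suc i , eq)
                                 (f zero , (zero , refl) , λ (i , eq) → contradiction (inj (sym eq)) 0≢1+n) ⟩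
    card (image? f)         ∎

-- Arithmetic of the bound

even-or-odd : ∀ n → ∃ λ p → n ≡ p + p ⊎ n ≡ suc (p + p)
even-or-odd zero = 0 , inj₁ refl
even-or-odd (suc n) with even-or-odd n
... | p , inj₁ n≡ = p , inj₂ (cong suc n≡)
... | p , inj₂ n≡ = suc p , inj₁ (cong suc (trans n≡ (sym (+-suc p p))))

-- For order 2p + 1, where `p + p` is the order minus one; `half-even` serves order 2p + 2. The left
-- sides are the forms in which walk lengths add up.
half-odd : ∀ p → suc (p * (p + p)) ≡ ⌈ (p + p) ^ 2 + 1 /2⌉
half-odd p = trans (cong suc (n≡⌊n+n/2⌋ (p * (p + p)))) (cong ⌈_/2⌉ (square p))
  where
  square : ∀ q → 1 + (q * (q + q) + q * (q + q)) ≡ (q + q) * ((q + q) * 1) + 1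
  square = solve-∀

half-even : ∀ p → suc (p * suc (p + p) + p) ≡ ⌈ (p + suc p) ^ 2 + 1 /2⌉
half-even p = trans (n≡⌈n+n/2⌉ (suc (p * suc (p + p) + p))) (cong ⌈_/2⌉ (square p))
  where
  square : ∀ q → 1 + (q * (1 + (q + q)) + q) + (1 + (q * (1 + (q + q)) + q)) ≡ (q + (1 + q)) * ((q + (1 + q)) * 1) + 1
  square = solve-∀

-- The left side counts `p` turns of a cycle of length `s` after the `suc e` steps that lead into
-- it. As p ≥ 1, `e` is at most `p * e`.
odd-budget : ∀ {s e} p → 1 ≤ p → s + suc e ≡ suc (p + p) → p * s + suc e ≤ suc (p * (p + p))
odd-budget {s} {e} p@(suc p′) _ s+1+e≡ = begin
  p * s + suc e        ≡⟨ +-suc (p * s) e ⟩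
  suc (p * s + e)      ≤⟨ s≤s (+-monoʳ-≤ (p * s) (m≤m+n e (p′ * e))) ⟩
  suc (p * s + p * e)  ≡⟨ cong suc (*-distribˡ-+ p s e) ⟨
  suc (p * (s + e))    ≡⟨ cong (λ m → suc (p * m)) (+-cancelˡ-≡ 1 _ _ (trans (sym (+-suc s e)) s+1+e≡)) ⟩
  suc (p * (p + p))    ∎

-- Here `d` further steps along the cycle are allowed. They cover at most half of it, and s ≤ 2p +
-- 1, so d ≤ p.
even-budget : ∀ {s e} p {d} → 1 ≤ s → s + suc e ≡ suc p + suc p → d + d ≤ s →
  p * s + d + suc e ≤ suc (p * suc (p + p) + p)
even-budget {s} {e} p {d} 1≤s s+1+e≡ 2d≤s = begin
  p * s + d + suc e          ≡⟨ +-suc (p * s + d) e ⟩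
  suc (p * s + d + e)        ≡⟨ cong suc (+-assoc (p * s) d e) ⟩
  suc (p * s + (d + e))      ≤⟨ s≤s (+-monoʳ-≤ (p * s) (+-mono-≤ d≤p (e≤p*e p s+e≡))) ⟩
  suc (p * s + (p + p * e))  ≡⟨ cong (λ m → suc (p * s + m)) (+-comm p (p * e)) ⟩
  suc (p * s + (p * e + p))  ≡⟨ cong suc (+-assoc (p * s) (p * e) p) ⟨
  suc (p * s + p * e + p)    ≡⟨ cong (λ m → suc (m + p)) (*-distribˡ-+ p s e) ⟨
  suc (p * (s + e) + p)      ≡⟨ cong (λ m → suc (p * m + p)) s+e≡ ⟩
  suc (p * suc (p + p) + p)  ∎
  where
  s+e≡ : s + e ≡ suc (p + p)
  s+e≡ = +-cancelˡ-≡ 1 _ _ (trans (sym (+-suc s e)) (trans s+1+e≡ (+-suc (suc p) p)))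

  d≤p : d ≤ p
  d≤p = ≮⇒≥ λ p<d → <-irrefl refl (begin-strict
    suc (p + p)        <⟨ n<1+n _ ⟩
    suc (suc (p + p))  ≡⟨ +-suc (suc p) p ⟨
    suc p + suc p      ≤⟨ +-mono-≤ p<d p<d ⟩
    d + d              ≤⟨ 2d≤s ⟩
    s                  ≤⟨ m≤m+n s e ⟩
    s + e              ≡⟨ s+e≡ ⟩
    suc (p + p)        ∎)

  e≤p*e : ∀ p → s + e ≡ suc (p + p) → e ≤ p * e
  -- For p = 0 the order is 2, so s = 1 and `e` vanishes.
  e≤p*e zero s+e≡1 = +-cancelˡ-≤ 1 e 0 (≤-trans (+-monoˡ-≤ e 1≤s) (≤-reflexive s+e≡1))
  e≤p*e (suc p) _ = m≤m+n e (p * e)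

-- Boolean products and walks

∧-true⁻ : ∀ {x y} → x ∧ y ≡ true → x ≡ true × y ≡ true
∧-true⁻ {true} {true} _ = refl , refl

⊗-true⁺ : ∀ {m k n} (A : BMatrix m k) (B : BMatrix k n) {i j} l →
  A i l ≡ true → B l j ≡ true → (A ⊗ B) i j ≡ true
⊗-true⁺ A B {i} {j} zero a b rewrite a | b = refl
⊗-true⁺ A B {i} {j} (suc l) a b with A i zero ∧ B zero j
... | true  = refl
... | false = ⊗-true⁺ (λ i l → A i (suc l)) (B ∘ suc) l a b

⊗-true⁻ : ∀ {m k n} (A : BMatrix m k) (B : BMatrix k n) {i j} →
  (A ⊗ B) i j ≡ true → ∃ λ l → A i l ≡ true × B l j ≡ true
⊗-true⁻ {k = suc k} A B {i} {j} eq with A i zero ∧ B zero j in eq₀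
... | true  = zero , ∧-true⁻ eq₀
... | false = let l , ab = ⊗-true⁻ (λ i l → A i (suc l)) (B ∘ suc) eq in suc l , ab

I-true⁺ : ∀ {n} (i : Fin n) → I i i ≡ true
I-true⁺ i = dec-true (i ≟ᶠ i) refl

I-true⁻ : ∀ {n} (i j : Fin n) → I i j ≡ true → i ≡ j
I-true⁻ i j eq with i ≟ᶠ j
... | yes i≡j = i≡j

module Walks {n : ℕ} (N : BMatrix n n) where

  Edge : Fin n → Fin n → Set
  Edge u w = N u w ≡ true

  infixr 5 _∷_ _⋈_

  data Walk : ℕ → Fin n → Fin n → Set where
    []  : ∀ {u} → Walk 0 u u
    _∷_ : ∀ {k u v w} → Edge u v → Walk k v w → Walk (suc k) u w

  walk⇒power : ∀ {k u w} → Walk k u w → (N ^ᵇ k) u w ≡ true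
  walk⇒power {u = u} [] = I-true⁺ u
  walk⇒power {suc k} (e ∷ p) = ⊗-true⁺ N (N ^ᵇ k) _ e (walk⇒power p)

  power⇒walk : ∀ k {u w} → (N ^ᵇ k) u w ≡ true → Walk k u w
  power⇒walk zero {u} {w} eq with refl ← I-true⁻ u w eq = []
  power⇒walk (suc k) eq = let _ , e , eq′ = ⊗-true⁻ N (N ^ᵇ k) eq in e ∷ power⇒walk k eq′

  walk? : ∀ k u → Decidable (Walk k u)
  walk? k u w = map′ (power⇒walk k) walk⇒power ((N ^ᵇ k) u w ≟ᵇ true)

  _⋈_ : ∀ {i j u v w} → Walk i u v → Walk j v w → Walk (i + j) u w
  []      ⋈ q = q
  (e ∷ p) ⋈ q = e ∷ p ⋈ q

  split : ∀ i {j u w} → Walk (i + j) u w → ∃ λ v → Walk i u v × Walk j v w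
  split zero p = _ , [] , p
  split (suc i) (e ∷ p) = let v , q , r = split i p in v , e ∷ q , r

  first-edge : ∀ {k u w} → 1 ≤ k → Walk k u w → ∃ (Edge u)
  first-edge _ (e ∷ _) = _ , e

  cast : ∀ {i j u w} → i ≡ j → Walk i u w → Walk j u w
  cast refl p = p

  -- Indexing the vertices by ℕ lets arcs be cut out by arithmetic on indices; values of `c` beyond
  -- `k` carry no meaning.
  trail : ∀ k {u w} → Walk k u w →
    ∃ λ (c : ℕ → Fin n) → c 0 ≡ u × c k ≡ w × (∀ i → i < k → Edge (c i) (c (suc i)))
  trail zero {u} [] = (λ _ → u) , refl , refl , λ _ ()
  trail (suc k) {u} (e ∷ p) with trail k p
  ... | c , refl , ck , edges = c′ , refl , ck , edges′
    where
    c′ : ℕ → Fin n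
    c′ zero = u
    c′ (suc i) = c i
    edges′ : ∀ i → i < suc k → Edge (c′ i) (c′ (suc i))
    edges′ zero _ = e
    edges′ (suc i) (s≤s i<k) = edges i i<k

  trail-walk : ∀ {k} {c : ℕ → Fin n} → (∀ i → i < k → Edge (c i) (c (suc i))) →
    ∀ d i → i + d ≤ k → Walk d (c i) (c (i + d))
  trail-walk {c = c} edges zero i _ rewrite +-identityʳ i = []
  trail-walk edges (suc d) i i+d≤k rewrite +-suc i d =
    edges i (≤-trans (s≤s (m≤m+n i d)) i+d≤k) ∷ trail-walk edges d (suc i) i+d≤k

  Disjoint : ℕ → Fin n → Fin n → Set
  Disjoint k u v = ∀ w → Walk k u w → ¬ Walk k v w

  disjoint-sym : ∀ {k u v} → Disjoint k u v → Disjoint k v u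
  disjoint-sym disj w p q = disj w q p

  ¬disjoint⇒meet : ∀ k u v → ¬ Disjoint k u v → ∃ λ w → Walk k u w × Walk k v w
  ¬disjoint⇒meet k u v ¬disj with any? (λ w → walk? k u w ×-dec walk? k v w)
  ... | yes w = w
  ... | no ¬w = contradiction (λ w p q → ¬w (w , p , q)) ¬disj

-- Reachability in a primitive digraph

module PrimitiveWalks {n : ℕ} (N : BMatrix n n) (prim : Primitive N) where

  open Walks N

  private
    r : ℕ
    r = proj₁ prim

  out-edge : ∀ u → ∃ (Edge u)
  out-edge u = first-edge (proj₁ (proj₂ prim)) (power⇒walk r (proj₂ (proj₂ prim) u u))

  out-walk : ∀ k u → ∃ (Walk k u)
  out-walk zero u = u , []
  out-walk (suc k) u =
    let v , e = out-edge u
        w , p = out-walk k v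
    in w , e ∷ p

  full-later : ∀ k u w → Walk (k + r) u w
  full-later zero u w = power⇒walk r (proj₂ (proj₂ prim) u w)
  full-later (suc k) u w = let v , e = out-edge u in e ∷ full-later k v w

  full-from : ∀ {k} → r ≤ k → ∀ u w → Walk k u w
  full-from {k} r≤k u w = cast (m∸n+n≡m r≤k) (full-later (k ∸ r) u w)

  -- Walks never get stuck, so a common end point at time `j` can be carried on to time `k`.
  disjoint-earlier : ∀ {j k u v} → j ≤ k → Disjoint k u v → Disjoint j u v
  disjoint-earlier {j} {k} j≤k disj x p q =
    let w , t = out-walk (k ∸ j) x
        eq = m+[n∸m]≡n j≤k
    in disj w (cast eq (p ⋈ t)) (cast eq (q ⋈ t))

  -- Iterating the inclusion sends every S (j + k t) into S j, and for k = r the former is already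
  -- everything.
  absorbing⇒full : ∀ {j t u} → 1 ≤ t → (∀ {w} → Walk (t + j) u w → Walk j u w) → ∀ w → Walk j u w
  absorbing⇒full {j} {t} {u} 1≤t absorb w = absorb* r (full-from r≤ u w)
    where
    shift : ∀ k → j + suc k * t ≡ (t + j) + k * t
    shift k = trans (sym (+-assoc j t (k * t))) (cong (_+ k * t) (+-comm j t))
    absorb* : ∀ k {w} → Walk (j + k * t) u w → Walk j u w
    absorb* zero p = cast (+-identityʳ j) p
    absorb* (suc k) p =
      let _ , q , q′ = split (t + j) {k * t} (cast (shift k) p)
      in absorb* k (absorb q ⋈ q′)
    r≤ : r ≤ j + r * t
    r≤ = begin
      r          ≡⟨ *-identityʳ r ⟨
      r * 1      ≤⟨ *-monoʳ-≤ r 1≤t ⟩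
      r * t      ≤⟨ m≤n+m (r * t) j ⟩
      j + r * t  ∎

  -- Prefixing the loop shows that each turn enlarges the reached set. A turn adding nothing would
  -- make the set full by `absorbing⇒full`, against the vertex `w` still missed at the end.
  growth : ∀ {s u} → 1 ≤ s → Walk s u u → ∀ m j → (∃ λ w → ¬ Walk (m * s + j) u w) →
    card (walk? j u) + m ≤ card (walk? (m * s + j) u)
  growth {s} {u} 1≤s loop zero j _ = ≤-reflexive (+-identityʳ _)
  growth {s} {u} 1≤s loop (suc m) j (w , ¬p) = begin
      card (walk? j u) + suc m          ≡⟨ +-suc _ m ⟩
      suc (card (walk? j u) + m)        ≤⟨ s≤s (growth 1≤s loop m j (w , ¬p ∘ grow)) ⟩
      suc (card (walk? (m * s + j) u))  ≤⟨ card-strict (walk? (m * s + j) u) (walk? (s + m * s + j) u) grow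
                                             (⊈-witness (walk? (m * s + j) u) (walk? (s + m * s + j) u) ⊈) ⟩
      card (walk? (s + m * s + j) u)    ∎
    where
    grow : ∀ {w} → Walk (m * s + j) u w → Walk (s + m * s + j) u w
    grow p = cast (sym (+-assoc s (m * s) j)) (loop ⋈ p)
    ⊈ : ¬ (∀ {w} → Walk (s + m * s + j) u w → Walk (m * s + j) u w)
    ⊈ sub = ¬p (grow (absorbing⇒full 1≤s (sub ∘ cast (sym (+-assoc s (m * s) j))) w))

  disjoint⇒missing : ∀ {k u v} → Disjoint k u v → ∃ λ w → ¬ Walk k u w
  disjoint⇒missing {k} {u} {v} disj = let w , q = out-walk k v in w , λ p → disj w p q

  -- Two vertices on closed walks of equal length

  module _ {s : ℕ} {u v : Fin n} (1≤s : 1 ≤ s) (loopᵤ : Walk s u u) (loopᵥ : Walk s v v) where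

    disjoint-growth : ∀ m j → Disjoint (m * s + j) u v →
      (card (walk? j u) + m) + (card (walk? j v) + m) ≤ n
    disjoint-growth m j disj = begin
      (card (walk? j u) + m) + (card (walk? j v) + m)
        ≤⟨ +-mono-≤ (growth 1≤s loopᵤ m j (disjoint⇒missing disj)) (growth 1≤s loopᵥ m j (disjoint⇒missing (disjoint-sym disj))) ⟩
      card (walk? (m * s + j) u) + card (walk? (m * s + j) v)
        ≤⟨ card-disjoint (walk? (m * s + j) u) (walk? (m * s + j) v) disj ⟩
      n ∎

    -- Each reached set starts with one vertex and gains one per turn, so after `p` turns two
    -- disjoint ones would need 2p + 2 vertices.
    meet-odd : ∀ p → n ≡ suc (p + p) → ∀ {k} → p * s ≤ k → ¬ Disjoint k u v
    meet-odd p n≡ {k} ps≤k disj = <-irrefl (sym n≡) (begin-strict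
      suc (p + p)                <⟨ n<1+n _ ⟩
      suc (suc (p + p))          ≡⟨ +-suc (suc p) p ⟨
      (1 + p) + (1 + p)          ≤⟨ +-mono-≤ (+-monoˡ-≤ p (card-nonempty (walk? 0 u) (out-walk 0 u))) (+-monoˡ-≤ p (card-nonempty (walk? 0 v) (out-walk 0 v))) ⟩
      (card (walk? 0 u) + p) + (card (walk? 0 v) + p)
                                 ≤⟨ disjoint-growth p 0 (disjoint-earlier (≤-trans (≤-reflexive (+-identityʳ (p * s))) ps≤k) disj) ⟩
      n                          ∎)

    meet-even : ∀ p → n ≡ suc p + suc p → ∀ {d} → Walk d u v →
      ∀ {k} → p * s + d ≤ k → ¬ Disjoint k u v
    -- Treated apart because `absorbing⇒full` needs the positive period `d + d`; here u = v.
    meet-even p n≡ {zero} [] _ disj =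
      disjoint-earlier z≤n disj u [] []
    meet-even p n≡ {d@(suc _)} u→v {k} a+d≤k disj =
      let w , ¬p = disjoint⇒missing disj-a in ¬p (absorbing⇒full {t = d + d} (s≤s z≤n) absorb w)
      where
      a : ℕ
      a = p * s + 0

      disj-a+d : Disjoint (p * s + d) u v
      disj-a+d = disjoint-earlier a+d≤k disj

      disj-a : Disjoint a u v
      disj-a = disjoint-earlier (≤-trans (+-monoʳ-≤ (p * s) z≤n) a+d≤k) disj

      disj-d+a : Disjoint (d + a) u v
      disj-d+a = disjoint-earlier (≤-trans (≤-reflexive eq) a+d≤k) disj
        where
        eq : d + a ≡ p * s + d
        eq = trans (cong (d +_) (+-identityʳ (p * s))) (+-comm d (p * s))

      -- After `p` turns from time `d`, the 2p + 2 vertices leave room for only one vertex in S d.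
      card-d≤1 : card (walk? d u) ≤ 1
      card-d≤1 = +-cancelʳ-≤ (p + suc p) _ _ (begin
        card (walk? d u) + (p + suc p)                   ≡⟨ +-assoc (card (walk? d u)) p (suc p) ⟨
        (card (walk? d u) + p) + (1 + p)                 ≤⟨ +-monoʳ-≤ (card (walk? d u) + p) (+-monoˡ-≤ p (card-nonempty (walk? d v) (out-walk d v))) ⟩
        (card (walk? d u) + p) + (card (walk? d v) + p)  ≤⟨ disjoint-growth p d disj-a+d ⟩
        n                                                ≡⟨ n≡ ⟩
        1 + (p + suc p)                                  ∎)

      cover : n ≤ card (walk? a u) + card (walk? a v)
      cover = begin
        n                  ≡⟨ n≡ ⟩
        (1 + p) + (1 + p)  ≤⟨ +-mono-≤ (+-monoˡ-≤ p (card-nonempty (walk? 0 u) (out-walk 0 u))) (+-monoˡ-≤ p (card-nonempty (walk? 0 v) (out-walk 0 v))) ⟩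
        (card (walk? 0 u) + p) + (card (walk? 0 v) + p)
                           ≤⟨ +-mono-≤ (growth 1≤s loopᵤ p 0 (disjoint⇒missing disj-a)) (growth 1≤s loopᵥ p 0 (disjoint⇒missing (disjoint-sym disj-a))) ⟩
        card (walk? a u) + card (walk? a v) ∎

      absorb : ∀ {w} → Walk (d + d + a) u w → Walk a u w
      -- After `d` steps the walk can only be at `v`, so `w` is reached from `v` in `d + a` steps.
      -- Were `w` also in T a, going through `v` would put it in S (d + a), contrary to
      -- disjointness.
      absorb {w} walk with split d {d + a} (cast (+-assoc d d a) walk)
      ... | x , u→x , x→w with refl ← card≤1⇒≡ (walk? d u) card-d≤1 u→x u→v =
        card-complement (walk? a u) (walk? a v) disj-a cover
          λ v→w → disj-d+a w (u→v ⋈ v→w) x→w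

  -- Shortest cycles

  Closed : Pred ℕ 0ℓ
  Closed k = ∃ λ x → Walk k x x

  closed? : Decidable Closed
  closed? k = any? λ x → walk? k x x

  -- With unique successors all walks of length `r` from `u` end at one vertex, yet primitivity lets
  -- them end at both `u` and `v`.
  functional⇒≡ : (∀ {x y z} → Edge x y → Edge x z → y ≡ z) → (u v : Fin n) → u ≡ v
  functional⇒≡ unique u v = unique-end (full-from ≤-refl u u) (full-from ≤-refl u v)
    where
    unique-end : ∀ {k x y z} → Walk k x y → Walk k x z → y ≡ z
    unique-end [] [] = refl
    unique-end (e ∷ p) (f ∷ q) with refl ← unique e f = unique-end p q

  module ShortestCycle {s : ℕ} (1≤s : 1 ≤ s) (shortest : ∀ k → 1 ≤ k → Closed k → s ≤ k)
                       {x : Fin n} (loop : Walk s x x) where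

    private
      c : ℕ → Fin n
      c = proj₁ (trail s loop)

      c₀≡x : c 0 ≡ x
      c₀≡x = proj₁ (proj₂ (trail s loop))

      cₛ≡x : c s ≡ x
      cₛ≡x = proj₁ (proj₂ (proj₂ (trail s loop)))

      edges : ∀ i → i < s → Edge (c i) (c (suc i))
      edges = proj₂ (proj₂ (proj₂ (trail s loop)))

      arc : ∀ {i j} → i ≤ j → j ≤ s → Walk (j ∸ i) (c i) (c j)
      arc {i} {j} i≤j j≤s =
        subst (Walk (j ∸ i) (c i)) (cong c (m+[n∸m]≡n i≤j))
          (trail-walk edges (j ∸ i) i (≤-trans (≤-reflexive (m+[n∸m]≡n i≤j)) j≤s))

      -- The complementary arc: onward from `c j` to `c s`, which is `c 0`, and then to `c i`.
      detour : ∀ {i j} → i ≤ j → j ≤ s → Walk (s ∸ (j ∸ i)) (c j) (c i)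
      detour {i} {j} i≤j j≤s =
        cast length (subst (Walk (s ∸ j) (c j)) (trans cₛ≡x (sym c₀≡x)) (arc j≤s ≤-refl) ⋈ arc z≤n (≤-trans i≤j j≤s))
        where
        length : s ∸ j + i ≡ s ∸ (j ∸ i)
        length = begin-equality
          s ∸ j + i                            ≡⟨ m+n∸n≡m (s ∸ j + i) (j ∸ i) ⟨
          s ∸ j + i + (j ∸ i) ∸ (j ∸ i)        ≡⟨ cong (_∸ (j ∸ i)) (+-assoc (s ∸ j) i (j ∸ i)) ⟩
          s ∸ j + (i + (j ∸ i)) ∸ (j ∸ i)      ≡⟨ cong (λ m → s ∸ j + m ∸ (j ∸ i)) (m+[n∸m]≡n i≤j) ⟩
          s ∸ j + j ∸ (j ∸ i)                  ≡⟨ cong (_∸ (j ∸ i)) (m∸n+n≡m j≤s) ⟩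
          s ∸ (j ∸ i)                          ∎

      -- A repeated vertex would cut off a closed walk of length `j ∸ i`, shorter than `s`.
      c-injective-< : ∀ {i j} → i < j → j < s → c i ≢ c j
      c-injective-< {i} {j} i<j j<s ci≡cj = <⇒≱ j<s (begin
        s      ≤⟨ shortest (j ∸ i) (m<n⇒0<n∸m i<j) (c i , subst (Walk (j ∸ i) (c i)) (sym ci≡cj) (arc (<⇒≤ i<j) (<⇒≤ j<s))) ⟩
        j ∸ i  ≤⟨ m∸n≤m j i ⟩
        j      ∎)

    vertex : Fin s → Fin n
    vertex i = c (toℕ i)

    vertex-injective : ∀ {i j} → vertex i ≡ vertex j → i ≡ j
    vertex-injective {i} {j} eq with <-cmp (toℕ i) (toℕ j)
    ... | tri< i<j _ _ = contradiction eq (c-injective-< i<j (toℕ<n j))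
    ... | tri≈ _ i≡j _ = toℕ-injective i≡j
    ... | tri> _ _ j<i = contradiction (sym eq) (c-injective-< j<i (toℕ<n i))

    vertex-loop : ∀ i → Walk s (vertex i) (vertex i)
    vertex-loop i = cast (cong (s ∸_) (n∸n≡0 (toℕ i))) (detour ≤-refl (<⇒≤ (toℕ<n i)))

    vertex-next : ∀ i → ∃ λ j → Edge (vertex i) (vertex j)
    vertex-next i with m≤n⇒m<n∨m≡n (toℕ<n i)
    ... | inj₁ 1+i<s = fromℕ< 1+i<s ,
      subst (Edge (vertex i)) (sym (cong c (toℕ-fromℕ< 1+i<s))) (edges (toℕ i) (toℕ<n i))
    -- The last vertex is followed by the first, since `c s` and `c 0` are both `x`.
    ... | inj₂ 1+i≡s = fromℕ< 1≤s ,
      subst (Edge (vertex i)) (trans (cong c 1+i≡s) (trans cₛ≡x (trans (sym c₀≡x) (cong c (sym (toℕ-fromℕ< 1≤s))))))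
        (edges (toℕ i) (toℕ<n i))

    hamiltonian : n ≤ s → ∀ y → ∃ λ i → vertex i ≡ y
    hamiltonian n≤s = card≥n⇒full (image? vertex) (≤-trans n≤s (card-image vertex vertex-injective))

    -- Any other edge out of `x` is a shortcut: to `c 0` it closes a walk of length 1, and to `c i`
    -- with i ≥ 2 one of length 1 + s - i.
    hamiltonian-successor : 2 ≤ s → n ≤ s → ∀ {y} → Edge x y → y ≡ c 1
    hamiltonian-successor 2≤s n≤s {y} e with hamiltonian n≤s y
    ... | i , refl = by-index (toℕ i) (toℕ<n i) e
      where
      by-index : ∀ i → i < s → Edge x (c i) → c i ≡ c 1
      by-index 0 _ e = contradiction (shortest 1 ≤-refl (x , subst (Edge x) c₀≡x e ∷ [])) (<⇒≱ 2≤s)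
      by-index 1 _ _ = refl
      by-index (suc (suc i)) 2+i<s e = contradiction
        (shortest (suc (s ∸ (2 + i))) (s≤s z≤n)
          (x , e ∷ subst (Walk (s ∸ (2 + i)) (c (2 + i))) cₛ≡x (arc (<⇒≤ 2+i<s) ≤-refl)))
        (<⇒≱ (begin-strict
          suc (s ∸ (2 + i))        <⟨ s≤s (∸-monoʳ-< (s≤s (s≤s z≤n)) (<⇒≤ 2+i<s)) ⟩
          suc (s ∸ 1)              ≡⟨ m+[n∸m]≡n 1≤s ⟩
          s                        ∎))

    private
      -- The two arcs joining the vertices have total length `s`, so one of them is at most half of
      -- it.
      shorter : ∀ {i j} → i ≤ j → j ≤ s → ∃ λ d → d + d ≤ s × (Walk d (c i) (c j) ⊎ Walk d (c j) (c i))
      shorter {i} {j} i≤j j≤s with (j ∸ i) + (j ∸ i) ≤? s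
      ... | yes 2d≤s = j ∸ i , 2d≤s , inj₁ (arc i≤j j≤s)
      ... | no 2d≰s  = s ∸ (j ∸ i) , (begin
        (s ∸ d) + (s ∸ d)  ≤⟨ +-monoʳ-≤ (s ∸ d) (m≤n+o⇒m∸n≤o s d (<⇒≤ (≰⇒> 2d≰s))) ⟩
        (s ∸ d) + d        ≡⟨ m∸n+n≡m (≤-trans (m∸n≤m j i) j≤s) ⟩
        s                  ∎) , inj₂ (detour i≤j j≤s)
        where
        d : ℕ
        d = j ∸ i

    short-arc : ∀ i j → ∃ λ d → d + d ≤ s × (Walk d (vertex i) (vertex j) ⊎ Walk d (vertex j) (vertex i))
    short-arc i j with ≤-total (toℕ i) (toℕ j)
    ... | inj₁ i≤j = shorter i≤j (<⇒≤ (toℕ<n j))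
    ... | inj₂ j≤i = let d , 2d≤s , p = shorter j≤i (<⇒≤ (toℕ<n i)) in d , 2d≤s , swap p

    private
      -- The length `k` is exact; the sets still increase with `k`, because a walk that has reached
      -- the cycle can continue round it.
      Enters : ℕ → Pred (Fin n) 0ℓ
      Enters k y = ∃ λ i → Walk k y (vertex i)

      enters? : ∀ k → Decidable (Enters k)
      enters? k y = any? λ i → walk? k y (vertex i)

      enters-suc : ∀ {k} → Enters k ⊆ Enters (suc k)
      enters-suc {k} (i , p) =
        let j , e = vertex-next i in j , cast (+-comm k 1) (p ⋈ e ∷ [])

      -- Once the sets stop growing, any long walk into the cycle can be replaced, working back from
      -- its tail, by one of length `k`.
      enters-stable : ∀ {k} → Enters (suc k) ⊆ Enters k → ∀ y → Enters k y
      enters-stable {k} sub y = descend r (full-from (m≤m+n r k) y (vertex i₀))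
        where
        i₀ : Fin s
        i₀ = fromℕ< 1≤s
        descend : ∀ m {y} → Walk (m + k) y (vertex i₀) → Enters k y
        descend zero p = i₀ , p
        descend (suc m) (e ∷ p) = let i , q = descend m p in sub (i , e ∷ q)

      enters-growth : ∀ k {y} → ¬ Enters k y → s + k ≤ card (enters? k)
      enters-growth zero _ = begin
        s + 0                 ≡⟨ +-identityʳ s ⟩
        s                     ≤⟨ card-image vertex vertex-injective ⟩
        card (image? vertex)  ≤⟨ card-mono (image? vertex) (enters? 0) (λ { (i , refl) → i , [] }) ⟩
        card (enters? 0)      ∎
      enters-growth (suc k) {y} ¬enters = begin
        s + suc k               ≡⟨ +-suc s k ⟩
        suc (s + k)             ≤⟨ s≤s (enters-growth k (¬enters ∘ enters-suc)) ⟩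
        suc (card (enters? k))  ≤⟨ card-strict (enters? k) (enters? (suc k)) enters-suc
                                     (⊈-witness (enters? k) (enters? (suc k)) λ sub → ¬enters (enters-suc (enters-stable sub y))) ⟩
        card (enters? (suc k))  ∎

    enter : ∀ {e} → s + e ≡ n → ∀ y → ∃ λ i → Walk e y (vertex i)
    enter {e} s+e≡n y = decidable-stable (enters? e y) λ ¬enters → <⇒≱ (card-missing (enters? e) y ¬enters) (begin
      n                 ≡⟨ s+e≡n ⟨
      s + e             ≤⟨ enters-growth e ¬enters ⟩
      card (enters? e)  ∎)

  -- The scrambling bound in terms of the order

  module _ (2≤n : 2 ≤ n) {s : ℕ} (1≤s : 1 ≤ s) (shortest : ∀ k → 1 ≤ k → Closed k → s ≤ k)
           {x : Fin n} (loop : Walk s x x) where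

    open ShortestCycle 1≤s shortest loop

    -- Otherwise the shortest cycle passes through every vertex and successors are unique, which
    -- primitivity forbids on two or more vertices.
    girth<n : s < n
    girth<n = ≰⇒> λ n≤s → 0≢1 (functional⇒≡ (unique n≤s) _ _)
      where
      0≢1 : fromℕ< (≤-trans (s≤s z≤n) 2≤n) ≢ fromℕ< 2≤n
      0≢1 eq = contradiction (begin-equality
        0                                      ≡⟨ toℕ-fromℕ< (≤-trans (s≤s z≤n) 2≤n) ⟨
        toℕ (fromℕ< (≤-trans (s≤s z≤n) 2≤n))   ≡⟨ cong toℕ eq ⟩
        toℕ (fromℕ< 2≤n)                       ≡⟨ toℕ-fromℕ< 2≤n ⟩
        1                                      ∎) λ ()
      loop-at : n ≤ s → ∀ y → Walk s y y
      loop-at n≤s y with i , refl ← hamiltonian n≤s y = vertex-loop i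
      unique : n ≤ s → ∀ {y z w} → Edge y z → Edge y w → z ≡ w
      unique n≤s {y} e f = trans (succ e) (sym (succ f))
        where
        succ : ∀ {z} → Edge y z → z ≡ _
        -- The successor lemma concerns only the base point, so the cycle is restarted at `y`.
        succ = ShortestCycle.hamiltonian-successor 1≤s shortest (loop-at n≤s y) (≤-trans 2≤n n≤s) n≤s

    scrambles-via-cycle : ∀ {e K} → s + e ≡ n → e ≤ K →
      (∀ i j → ¬ Disjoint (K ∸ e) (vertex i) (vertex j)) → Scrambles N K
    scrambles-via-cycle {e} {K} s+e≡n e≤K meet u v =
      let i , p = enter s+e≡n u
          j , q = enter s+e≡n v
          w , p′ , q′ = ¬disjoint⇒meet (K ∸ e) _ _ (meet i j)
          eq = m+[n∸m]≡n e≤K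
      in w , walk⇒power (cast eq (p ⋈ p′)) , walk⇒power (cast eq (q ⋈ q′))

    private
      e : ℕ
      e = n ∸ suc s

      s+1+e≡n : s + suc e ≡ n
      s+1+e≡n = trans (+-suc s e) (m+[n∸m]≡n girth<n)

    scrambles-odd : ∀ p → n ≡ suc (p + p) → Scrambles N (suc (p * (p + p)))
    scrambles-odd p n≡ = scrambles-via-cycle s+1+e≡n (m+n≤o⇒n≤o (p * s) budget)
      λ i j → meet-odd 1≤s (vertex-loop i) (vertex-loop j) p n≡ (m+n≤o⇒m≤o∸n (p * s) budget)
      where
      1≤p : ∀ p → n ≡ suc (p + p) → 1 ≤ p
      1≤p zero n≡1 = contradiction (≤-trans 2≤n (≤-reflexive n≡1)) (<⇒≱ ≤-refl)
      1≤p (suc p) _ = s≤s z≤n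

      budget : p * s + suc e ≤ suc (p * (p + p))
      budget = odd-budget p (1≤p p n≡) (trans s+1+e≡n n≡)

    scrambles-even : ∀ p → n ≡ suc p + suc p → Scrambles N (suc (p * suc (p + p) + p))
    scrambles-even p n≡ =
      scrambles-via-cycle s+1+e≡n (m+n≤o⇒n≤o (p * s + 0) (budget z≤n)) λ i j → meet (short-arc i j)
      where
      budget : ∀ {d} → d + d ≤ s → p * s + d + suc e ≤ suc (p * suc (p + p) + p)
      budget = even-budget p 1≤s (trans s+1+e≡n n≡)

      meet : ∀ {i j} →
        (∃ λ d → d + d ≤ s × (Walk d (vertex i) (vertex j) ⊎ Walk d (vertex j) (vertex i))) →
        ¬ Disjoint (suc (p * suc (p + p) + p) ∸ suc e) (vertex i) (vertex j)
      meet {i} {j} (d , 2d≤s , inj₁ i→j) =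
        meet-even 1≤s (vertex-loop i) (vertex-loop j) p n≡ i→j (m+n≤o⇒m≤o∸n (p * s + d) (budget 2d≤s))
      meet {i} {j} (d , 2d≤s , inj₂ j→i) =
        meet-even 1≤s (vertex-loop j) (vertex-loop i) p n≡ j→i (m+n≤o⇒m≤o∸n (p * s + d) (budget 2d≤s)) ∘ disjoint-sym

  -- Splitting on the parity of `n ∸ 2` gives `n` directly as 2p + 2 or 2p + 3; the odd case
  -- therefore uses `suc p`.
  scrambles-by-parity : 2 ≤ n → (∃ λ p → n ∸ 2 ≡ p + p ⊎ n ∸ 2 ≡ suc (p + p)) →
    ∃ (IsLeastPositive Closed) → Scrambles N ⌈ (n ∸ 1) ^ 2 + 1 /2⌉
  scrambles-by-parity 2≤n (p , inj₁ n-2≡) (s , 1≤s , (x , loop) , shortest) =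
    subst (Scrambles N) eq (scrambles-even 2≤n 1≤s shortest loop p n≡)
    where
    n≡ : n ≡ suc p + suc p
    n≡ = trans (sym (m+[n∸m]≡n 2≤n)) (trans (cong (2 +_) n-2≡) (cong suc (sym (+-suc p p))))
    eq : suc (p * suc (p + p) + p) ≡ ⌈ (n ∸ 1) ^ 2 + 1 /2⌉
    eq = trans (half-even p) (cong (λ k → ⌈ (k ∸ 1) ^ 2 + 1 /2⌉) (sym n≡))
  scrambles-by-parity 2≤n (p , inj₂ n-2≡) (s , 1≤s , (x , loop) , shortest) =
    subst (Scrambles N) eq (scrambles-odd 2≤n 1≤s shortest loop (suc p) n≡)
    where
    n≡ : n ≡ suc (suc p + suc p)
    n≡ = trans (sym (m+[n∸m]≡n 2≤n)) (trans (cong (2 +_) n-2≡) (cong (2 +_) (sym (+-suc p p))))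
    eq : suc (suc p * (suc p + suc p)) ≡ ⌈ (n ∸ 1) ^ 2 + 1 /2⌉
    eq = trans (half-odd (suc p)) (cong (λ k → ⌈ (k ∸ 1) ^ 2 + 1 /2⌉) (sym n≡))

akelbek-kirkland : ∀ {n} (N : BMatrix n n) → Primitive N → Scrambles N ⌈ (n ∸ 1) ^ 2 + 1 /2⌉
akelbek-kirkland {zero} N prim ()
akelbek-kirkland {suc zero} N prim zero zero =
  -- For order 1, which occurs when the rank is 1, the bound evaluates to 1.
  let w , p = out-walk 1 zero in w , walk⇒power p , walk⇒power p
  where
  open Walks N
  open PrimitiveWalks N prim
akelbek-kirkland {suc (suc m)} N prim@(r , 1≤r , _) =
  scrambles-by-parity (s≤s (s≤s z≤n)) (even-or-odd m)
    (leastPositive closed? r 1≤r (zero , full-from ≤-refl zero zero))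
  where
  open PrimitiveWalks N prim

-- Exchanging the factors of M = A B

module Factorisation {n b : ℕ} (M : BMatrix n n) (A : BMatrix n b) (B : BMatrix b n) (M≐AB : M ≐ A ⊗ B) where

  open Walks

  N : BMatrix b b
  N = B ⊗ A

  edge⇒factors : ∀ {i j} → Edge M i j → ∃ λ p → A i p ≡ true × B p j ≡ true
  edge⇒factors e = ⊗-true⁻ A B (trans (sym (M≐AB _ _)) e)

  factors⇒edge : ∀ {i j p} → A i p ≡ true → B p j ≡ true → Edge M i j
  factors⇒edge a b = trans (M≐AB _ _) (⊗-true⁺ A B _ a b)

  -- Walk form of A (BA)ᵏ B = (AB)ᵏ⁺¹.
  enclose : ∀ {k i j p q} → A i p ≡ true → Walk N k p q → B q j ≡ true → Walk M (suc k) i j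
  enclose a [] b = factors⇒edge a b ∷ []
  enclose a (e ∷ w) b = let _ , b′ , a′ = ⊗-true⁻ B A e in factors⇒edge a b′ ∷ enclose a′ w b

  -- Walk form of B (AB)ᵏ = (BA)ᵏ B.
  slide : ∀ {k i j p} → B p i ≡ true → Walk M k i j → ∃ λ q → Walk N k p q × B q j ≡ true
  slide b [] = _ , [] , b
  slide b (e ∷ w) =
    let _ , a , b′ = edge⇒factors e
        q , w′ , b″ = slide b′ w
    in q , ⊗-true⁺ B A _ b a ∷ w′ , b″

  -- Nʳ⁺¹ = B Mʳ A = B J A, and this is J when `B` has no zero row and `A` no zero column.
  swap-primitive : (∀ p → ∃ λ j → B p j ≡ true) → (∀ q → ∃ λ i → A i q ≡ true) → Primitive M → Primitive N
  swap-primitive rowB colA (r , _ , Mʳ≐J) = r + 1 , m≤n+m 1 r , λ p q →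
    let i , b = rowB p
        j , a = colA q
        _ , w , b′ = slide b (power⇒walk M r (Mʳ≐J i j))
    in walk⇒power N (_⋈_ N w (⊗-true⁺ B A j b′ a ∷ []))

  swap-scrambles : (∀ p → ∃ λ j → B p j ≡ true) → (∀ i → ∃ (Edge M i)) → ∀ k → Scrambles N k → Scrambles M (suc k)
  swap-scrambles rowB rowM k scr i j =
    let p , a , _ = edge⇒factors (proj₂ (rowM i))
        q , a′ , _ = edge⇒factors (proj₂ (rowM j))
        l , w , w′ = scr p q
        x , b = rowB l
    in x , walk⇒power M (enclose a (power⇒walk N k w) b) , walk⇒power M (enclose a′ (power⇒walk N k w′) b)

-- Minimality of the Boolean rank

dispensable⇒smaller : ∀ {m n b} {M : BMatrix m n} (A : BMatrix m (suc b)) (B : BMatrix (suc b) n) →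
  M ≐ A ⊗ B → ∀ p →
  (∀ {i j} → A i p ≡ true → ¬ B p j ≡ true) → FactorsThrough M b
dispensable⇒smaller {m} {n} A B M≐AB p useless = A′ , B′ , λ i j → trans (M≐AB i j) (≡-of-⇔ forth back)
  where
  A′ : BMatrix m _
  A′ i l = A i (punchIn p l)
  B′ : BMatrix _ n
  B′ l = B (punchIn p l)
  ≡-of-⇔ : ∀ {x y} → (x ≡ true → y ≡ true) → (y ≡ true → x ≡ true) → x ≡ y
  ≡-of-⇔ {true} f g = sym (f refl)
  ≡-of-⇔ {false} {false} f g = refl
  ≡-of-⇔ {false} {true} f g = g refl
  back : ∀ {i j} → (A′ ⊗ B′) i j ≡ true → (A ⊗ B) i j ≡ true
  back eq = let l , a , b = ⊗-true⁻ A′ B′ eq in ⊗-true⁺ A B (punchIn p l) a b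
  forth : ∀ {i j} → (A ⊗ B) i j ≡ true → (A′ ⊗ B′) i j ≡ true
  forth {i} {j} eq with ⊗-true⁻ A B eq
  ... | l , a , b with p ≟ᶠ l
  ...   | yes refl = contradiction b (useless a)
  ...   | no p≢l = ⊗-true⁺ A′ B′ (punchOut p≢l)
    (subst (λ l → A i l ≡ true) (sym (punchIn-punchOut p≢l)) a)
    (subst (λ l → B l j ≡ true) (sym (punchIn-punchOut p≢l)) b)

rank⇒used : ∀ {m n b} {M : BMatrix m n} → IsBooleanRank M b → (∃ λ i → ∃ λ j → M i j ≡ true) →
  (A : BMatrix m b) (B : BMatrix b n) → M ≐ A ⊗ B → ∀ p → ∃ λ i → ∃ λ j → A i p ≡ true × B p j ≡ true
rank⇒used {b = suc b} {M} (_ , _ , least) (x , y , Mxy) A B M≐AB p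
  with any? (λ i → any? λ j → (A i p ≟ᵇ true) ×-dec (B p j ≟ᵇ true))
... | yes used = used
... | no unused = ⊥-elim (impossible (dispensable⇒smaller A B M≐AB p λ a b → unused (_ , _ , a , b)))
  where
  impossible : ¬ FactorsThrough M b
  impossible factors with 1 ≤? b
  ... | yes 1≤b = <-irrefl refl (least b 1≤b factors)
  -- Leastness speaks of positive dimensions only. Through dimension 0 every entry of the product is
  -- an empty sum, whereas `M` has an entry 1.
  impossible (A′ , B′ , M≐) | no 1≰b with refl ← n<1⇒n≡0 (≰⇒> 1≰b)
    with () ← trans (sym Mxy) (M≐ x y)

theorem2p3 : (n : ℕ) → 2 ≤ n → (M : BMatrix n n) → (prim : Primitive M) →
    (b : ℕ) → IsBooleanRank M b →
    k⟨ M , prim ⟩ ≤ ⌈ (b ∸ 1) ^ 2 + 1 /2⌉ + 1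
theorem2p3 n 2≤n M prim b rank@(_ , (A , B , M≐AB) , _) =
  -- The scrambling index is least, so it suffices that the exponent `K + 1` scrambles.
  proj₂ (proj₂ (proj₂ (scramblingIndex M prim))) (K + 1) (m≤n+m 1 K)
    (subst (Scrambles M) (+-comm 1 K)
      (swap-scrambles rowB out-edge K (akelbek-kirkland N (swap-primitive rowB colA prim))))
  where
  open PrimitiveWalks M prim using (out-edge)
  open Factorisation M A B M≐AB

  K : ℕ
  K = ⌈ (b ∸ 1) ^ 2 + 1 /2⌉

  used : ∀ p → ∃ λ i → ∃ λ j → A i p ≡ true × B p j ≡ true
  used = rank⇒used rank (fromℕ< 2≤n , out-edge _) A B M≐AB

  rowB : ∀ p → ∃ λ j → B p j ≡ true
  rowB p = let _ , j , _ , b = used p in j , b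

  colA : ∀ q → ∃ λ i → A i q ≡ true
  colA q = let i , _ , a , _ = used q in i , a
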